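{- For all integers $n\geq 0$, $p_{\mathrm{eu}}^{\mathrm{ou}}(n)\leq p^{\mathrm{eu}}_{\mathrm{ou}}(n)$. Moreover, $p_{\mathrm{eu}}^{\mathrm{ou}}(n)< p^{\mathrm{eu}}_{\mathrm{ou}}(n)$ for all $n\geq 3$.
   Context: A partition of a non-negative integer $n$ is a non-increasing (finite, possibly empty) sequence of positive integers, called parts, summing to $n$. $p_{\mathrm{eu}}^{\mathrm{ou}}(n)$ is the number of partitions of $n$ in which every odd part is larger than every even part (no restriction on multiplicities of parts). $p^{\mathrm{eu}}_{\mathrm{ou}}(n)$ is the number of partitions of $n$ in which every even part is larger than every odd part (no restriction on multiplicities of parts). In both cases partitions with no even parts or with no odd parts are allowed. -}

module Defs where

open import Data.List using (List; []; _∷_; _++_; map; filter; length)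
open import Data.List.Membership.Propositional using (_∈_)
open import Data.List.Membership.Propositional.Properties
  using (∈-map⁺; ∈-map⁻; ∈-++⁺ˡ; ∈-++⁺ʳ; ∈-++⁻; ∈-filter⁺; ∈-filter⁻)
open import Data.List.Relation.Binary.Disjoint.Propositional using (Disjoint)
open import Data.List.Relation.Unary.All using (All; []; _∷_; all?)
open import Data.List.Relation.Unary.AllPairs using ([]; _∷_)
open import Data.List.Relation.Unary.Any using (here; there)
open import Data.List.Relation.Unary.Linked using (Linked; linked?)
open import Data.List.Relation.Unary.Unique.Propositional using (Unique)
import Data.List.Relation.Unary.Unique.Propositional.Properties as Unique
open import Data.Nat using (ℕ; zero; suc; _≥_; _>_; _≥?_; _>?_; _≟_; z≤n; s≤s)
open import Data.Nat.Divisibility using (_∣_; _∣?_)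
open import Data.Nat.ListAction using (sum)
open import Data.Nat.Properties using (suc-injective)
open import Data.Product using (_×_; _,_; proj₂)
open import Data.Sum using (inj₁; inj₂)
open import Relation.Binary.PropositionalEquality using (_≡_; refl)
open import Relation.Nullary using (Dec; ¬_; ¬?; _×-dec_; _→-dec_)

Even Odd : ℕ → Set
Even m = 2 ∣ m
Odd  m = ¬ Even m

even? : ∀ m → Dec (Even m)
even? m = 2 ∣? m

odd? : ∀ m → Dec (Odd m)
odd? m = ¬? (even? m)

IsPartition : ℕ → List ℕ → Set
IsPartition n λs = Linked _≥_ λs × All (_> 0) λs × sum λs ≡ n

isPartition? : ∀ n λs → Dec (IsPartition n λs)
isPartition? n λs = linked? _≥?_ λs ×-dec all? (_>? 0) λs ×-dec (sum λs ≟ n)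

OddAboveEven EvenAboveOdd : List ℕ → Set
OddAboveEven λs = All (λ x → All (λ y → Odd x → Even y → x > y) λs) λs
EvenAboveOdd λs = All (λ x → All (λ y → Even x → Odd y → x > y) λs) λs

oddAboveEven? : ∀ λs → Dec (OddAboveEven λs)
oddAboveEven? λs =
  all? (λ x → all? (λ y → odd? x →-dec (even? y →-dec (x >? y))) λs) λs

evenAboveOdd? : ∀ λs → Dec (EvenAboveOdd λs)
evenAboveOdd? λs =
  all? (λ x → all? (λ y → even? x →-dec (odd? y →-dec (x >? y))) λs) λs

bump : List ℕ → List ℕ
bump []       = []
bump (x ∷ xs) = suc x ∷ xs

-- All finite sequences of positive integers with sum n, in any order: the
-- first part is either 1 or one more than the first part of a composition of
-- n - 1. This only serves to make the partitions of n a concrete list.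
compositions : ℕ → List (List ℕ)
compositions 0             = [] ∷ []
compositions 1             = (1 ∷ []) ∷ []
compositions (suc (suc n)) =
  map (1 ∷_) (compositions (suc n)) ++ map bump (compositions (suc n))

-- Each partition of n occurs exactly once in this list; see
-- ∈-partitions⁺, ∈-partitions⁻ and partitions-unique.
partitions : ℕ → List (List ℕ)
partitions n = filter (isPartition? n) (compositions n)

-- Superscript "ou": odd parts, unrestricted multiplicity, lie above the even ones.
pᵒᵘₑᵤ : ℕ → ℕ
pᵒᵘₑᵤ n = length (filter oddAboveEven? (partitions n))

pᵉᵘₒᵤ : ℕ → ℕ
pᵉᵘₒᵤ n = length (filter evenAboveOdd? (partitions n))

∈-compositions⁺ : ∀ n {xs} → All (_> 0) xs → sum xs ≡ n → xs ∈ compositions n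
∈-compositions⁺ 0 {[]} _ _ = here refl
∈-compositions⁺ 0 {zero ∷ _} (() ∷ _) _
∈-compositions⁺ 1 {zero ∷ _} (() ∷ _) _
∈-compositions⁺ 1 {1 ∷ []} _ _ = here refl
∈-compositions⁺ 1 {1 ∷ zero ∷ _} (_ ∷ () ∷ _) _
∈-compositions⁺ (suc (suc n)) {zero ∷ _} (() ∷ _) _
∈-compositions⁺ (suc (suc n)) {1 ∷ xs} (_ ∷ ps) eq =
  ∈-++⁺ˡ (∈-map⁺ (1 ∷_) (∈-compositions⁺ (suc n) ps (suc-injective eq)))
∈-compositions⁺ (suc (suc n)) {suc (suc x) ∷ xs} (_ ∷ ps) eq =
  ∈-++⁺ʳ (map (1 ∷_) (compositions (suc n)))
    (∈-map⁺ bump (∈-compositions⁺ (suc n) {suc x ∷ xs} (s≤s z≤n ∷ ps) (suc-injective eq)))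

compositions-positive : ∀ n {xs} → xs ∈ compositions n → All (_> 0) xs
compositions-positive 0 (here refl) = []
compositions-positive 1 (here refl) = s≤s z≤n ∷ []
compositions-positive (suc (suc n)) i with ∈-++⁻ (map (1 ∷_) (compositions (suc n))) i
... | inj₁ j with _ , k , refl ← ∈-map⁻ (1 ∷_) j =
  s≤s z≤n ∷ compositions-positive (suc n) k
... | inj₂ j with ∈-map⁻ bump j
...   | []    , k , refl = []
...   | _ ∷ _ , k , refl with _ ∷ ps ← compositions-positive (suc n) k = s≤s z≤n ∷ ps

bump-injective : ∀ {xs ys} → bump xs ≡ bump ys → xs ≡ ys
bump-injective {[]}    {[]}    _    = refl
bump-injective {_ ∷ _} {_ ∷ _} refl = refl

compositions-unique : ∀ n → Unique (compositions n)
compositions-unique 0 = [] ∷ []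
compositions-unique 1 = [] ∷ []
compositions-unique (suc (suc n)) =
  Unique.++⁺ (Unique.map⁺ (λ { refl → refl }) (compositions-unique (suc n)))
             (Unique.map⁺ bump-injective (compositions-unique (suc n)))
             disjoint
  where
  disjoint : Disjoint (map (1 ∷_) (compositions (suc n))) (map bump (compositions (suc n)))
  disjoint (i , j) with ∈-map⁻ (1 ∷_) i | ∈-map⁻ bump j
  ... | _ , _ , refl | zero ∷ _ , k , refl with () ∷ _ ← compositions-positive (suc n) k

∈-partitions⁺ : ∀ {n λs} → IsPartition n λs → λs ∈ partitions n
∈-partitions⁺ {n} p@(_ , pos , eq) =
  ∈-filter⁺ (isPartition? n) (∈-compositions⁺ n pos eq) p

∈-partitions⁻ : ∀ {n λs} → λs ∈ partitions n → IsPartition n λs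
∈-partitions⁻ {n} i = proj₂ (∈-filter⁻ (isPartition? n) {xs = compositions n} i)

partitions-unique : ∀ n → Unique (partitions n)
partitions-unique n = Unique.filter⁺ (isPartition? n) (compositions-unique n)

{-# OPTIONS --safe #-}

-- Replace every odd part o by o - 1 (dropping it if it is 0) and a part 1. The
-- image has even parts above ones, so it is counted by pᵉᵘₒᵤ. When the odd parts
-- of the original lie above its even parts, the original is recovered by adding
-- the k ones to the k largest even parts, padded by zeros. A partition whose
-- parts are all odd and whose largest part exceeds 1 is not in the image; such a
-- partition of n exists for all n ≥ 3, namely (n) or (n - 1, 1).
module Submission where

open import Defs
open import Data.List using (List; []; _∷_; [_]; _++_; map; filter; length; replicate)
open import Data.List.Membership.Propositional using (_∈_; _∉_)
open import Data.List.Membership.Propositional.Properties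
  using (∈-∃++; ∈-++⁺ˡ; ∈-++⁺ʳ; ∈-++⁻; ∈-filter⁺; ∈-filter⁻; ∈-map⁻)
open import Data.List.Properties
  using (length-++; length-map; length-replicate; map-∘; map-id-local;
         filter-all; filter-none; filter-++; ++-identityʳ)
open import Data.List.Relation.Binary.Subset.Propositional using (_⊆_)
open import Data.List.Relation.Unary.All as All using (All; []; _∷_)
import Data.List.Relation.Unary.All.Properties as All
open import Data.List.Relation.Unary.AllPairs as AllPairs using (AllPairs; []; _∷_)
import Data.List.Relation.Unary.AllPairs.Properties as AllPairs
open import Data.List.Relation.Unary.Any using (here; there)
open import Data.List.Relation.Unary.Linked using ([-]; _∷_)
open import Data.List.Relation.Unary.Linked.Properties using (Linked⇒AllPairs; AllPairs⇒Linked)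
open import Data.List.Relation.Unary.Unique.Propositional using (Unique)
import Data.List.Relation.Unary.Unique.Propositional.Properties as Unique
open import Data.Nat
open import Data.Nat.DivMod
open import Data.Nat.Divisibility
open import Data.Nat.ListAction using (sum)
open import Data.Nat.ListAction.Properties using (sum-++)
open import Data.Nat.Properties
open import Algebra.Properties.CommutativeSemigroup +-commutativeSemigroup using (interchange)
open import Data.Product using (_×_; _,_; proj₁; proj₂; ∃₂)
open import Data.Sum using (_⊎_; inj₁; inj₂)
open import Relation.Binary.PropositionalEquality
  using (_≡_; refl; sym; trans; cong; cong₂; subst; module ≡-Reasoning)
open import Relation.Nullary using (yes; no; contradiction)

-- Comparing lengths of duplicate-free lists.

-- Induction by cutting one occurrence of the head out of `ys`: the entries of the tail differ from
-- the head, so they survive the cut.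
Unique-⊆⇒length≤ : ∀ {A : Set} {xs ys : List A} → Unique xs → xs ⊆ ys → length xs ≤ length ys
Unique-⊆⇒length≤ [] _ = z≤n
Unique-⊆⇒length≤ {xs = x ∷ xs} (x∉xs ∷ unique) sub with ∈-∃++ (sub (here refl))
... | as , bs , refl = begin
  suc (length xs)             ≤⟨ s≤s (Unique-⊆⇒length≤ unique sub′) ⟩
  suc (length (as ++ bs))     ≡⟨ cong suc (length-++ as) ⟩
  suc (length as + length bs) ≡⟨ +-suc (length as) (length bs) ⟨
  length as + suc (length bs) ≡⟨ length-++ as ⟨
  length (as ++ x ∷ bs)       ∎
  where
  open ≤-Reasoning
  sub′ : xs ⊆ as ++ bs
  sub′ i with ∈-++⁻ as (sub (there i))
  ... | inj₁ j            = ∈-++⁺ˡ j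
  ... | inj₂ (here eq)    = contradiction (sym eq) (All.lookup x∉xs i)
  ... | inj₂ (there j)    = ∈-++⁺ʳ as j

-- `map g` turns `map f xs` back into `xs`, and a repetition before `map g` would persist after it.
-- Inverting `f` on the entries of `xs` is enough; this matters because `split` is not injective on
-- all lists.
Unique-map-leftInverse : ∀ {A B : Set} (f : A → B) (g : B → A) {xs} →
  All (λ x → g (f x) ≡ x) xs → Unique xs → Unique (map f xs)
Unique-map-leftInverse f g {xs} inverse unique = Unique.map⁻ {f = g}
  (subst Unique (sym (trans (sym (map-∘ xs)) (map-id-local inverse))) unique)

-- Parity and rounding down to an even number.

%2-cases : ∀ x → x % 2 ≡ 0 ⊎ x % 2 ≡ 1
%2-cases x with x % 2 | m%n<n x 2
... | 0           | _             = inj₁ refl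
... | 1           | _             = inj₂ refl
... | suc (suc _) | s≤s (s≤s ())

odd-1 : Odd 1
odd-1 2∣1 with () ← ∣1⇒≡1 2∣1

even-suc⇒odd : ∀ {m} → Even (suc m) → Odd m
even-suc⇒odd {m} 2∣1+m 2∣m = odd-1 (∣m+n∣m⇒∣n (subst Even (+-comm 1 m) 2∣1+m) 2∣m)

odd⇒%2≡1 : ∀ {x} → Odd x → x % 2 ≡ 1
odd⇒%2≡1 {x} odd with %2-cases x
... | inj₁ eq = contradiction (m%n≡0⇒n∣m x 2 eq) odd
... | inj₂ eq = eq

odd⇒suc-evenPart : ∀ {x} → Odd x → suc (x / 2 * 2) ≡ x
odd⇒suc-evenPart {x} odd =
  sym (trans (m≡m%n+[m/n]*n x 2) (cong (_+ x / 2 * 2) (odd⇒%2≡1 odd)))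

-- Splitting ones off the odd parts, and the way back.

evenParts : List ℕ → List ℕ
evenParts = map (λ x → x / 2 * 2)

lower : List ℕ → List ℕ
lower xs = filter (_>? 0) (evenParts xs)

-- As a sum of remainders, this complements `evenParts` entry by entry through division with
-- remainder.
oddCount : List ℕ → ℕ
oddCount xs = sum (map (_% 2) xs)

split : List ℕ → List ℕ
split xs = lower xs ++ replicate (oddCount xs) 1

raise : ℕ → List ℕ → List ℕ
raise zero    xs       = xs
-- Beyond its end the list counts as padded by zeros; this restores the parts 1 that `lower` drops.
raise (suc k) []       = 1 ∷ raise k []
raise (suc k) (x ∷ xs) = suc x ∷ raise k xs

-- On a list `split xs`, parity alone separates the lowered parts from the ones.
unsplit : List ℕ → List ℕ
unsplit xs = raise (length (filter odd? xs)) (filter even? xs)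

-- Where the image of `split` lies.

lower-even : ∀ xs → All Even (lower xs)
lower-even xs = All.filter⁺ (_>? 0) (All.map⁺ (All.universal (λ x → n∣m*n (x / 2)) xs))

sum-filter-positive : ∀ xs → sum (filter (_>? 0) xs) ≡ sum xs
sum-filter-positive []           = refl
sum-filter-positive (zero  ∷ xs) = sum-filter-positive xs
sum-filter-positive (suc x ∷ xs) = cong (suc x +_) (sum-filter-positive xs)

sum-replicate-1 : ∀ k → sum (replicate k 1) ≡ k
sum-replicate-1 zero    = refl
sum-replicate-1 (suc k) = cong suc (sum-replicate-1 k)

sum-evenParts : ∀ xs → sum (evenParts xs) + oddCount xs ≡ sum xs
sum-evenParts []       = refl
sum-evenParts (x ∷ xs) = begin
  (x / 2 * 2 + es) + (x % 2 + oddCount xs) ≡⟨ interchange (x / 2 * 2) es (x % 2) (oddCount xs) ⟩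
  (x / 2 * 2 + x % 2) + (es + oddCount xs) ≡⟨ cong₂ _+_ (+-comm (x / 2 * 2) (x % 2)) (sum-evenParts xs) ⟩
  (x % 2 + x / 2 * 2) + sum xs             ≡⟨ cong (_+ sum xs) (m≡m%n+[m/n]*n x 2) ⟨
  x + sum xs                               ∎
  where
  open ≡-Reasoning
  es = sum (evenParts xs)

sum-split : ∀ xs → sum (split xs) ≡ sum xs
sum-split xs = begin
  sum (lower xs ++ replicate (oddCount xs) 1)         ≡⟨ sum-++ (lower xs) _ ⟩
  sum (lower xs) + sum (replicate (oddCount xs) 1)    ≡⟨ cong₂ _+_
                                                            (sum-filter-positive (evenParts xs))
                                                            (sum-replicate-1 (oddCount xs)) ⟩
  sum (evenParts xs) + oddCount xs                    ≡⟨ sum-evenParts xs ⟩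
  sum xs                                              ∎
  where open ≡-Reasoning

split-positive : ∀ xs → All (_> 0) (split xs)
split-positive xs = All.++⁺ (All.all-filter (_>? 0) (evenParts xs)) (All.replicate⁺ (oddCount xs) ≤-refl)

-- Serves twice: to place the image among the partitions with even parts above odd ones, and to keep
-- any list with an odd part above 1 out of it.
split-odd≡1 : ∀ xs → All (λ x → Odd x → x ≡ 1) (split xs)
split-odd≡1 xs =
  All.++⁺ (All.map (λ even odd → contradiction even odd) (lower-even xs))
          (All.replicate⁺ (oddCount xs) (λ _ → refl))

replicate-≥ : ∀ k {x} → AllPairs _≥_ (replicate k x)
replicate-≥ zero    = []
replicate-≥ (suc k) = All.replicate⁺ k ≤-refl ∷ replicate-≥ k

≥-trans : ∀ {x y z} → x ≥ y → y ≥ z → x ≥ z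
≥-trans x≥y y≥z = ≤-trans y≥z x≥y

split-≥ : ∀ {xs} → AllPairs _≥_ xs → AllPairs _≥_ (split xs)
split-≥ {xs} sorted = AllPairs.++⁺
  (AllPairs.filter⁺ (_>? 0)
    (AllPairs.map⁺ (AllPairs.map (λ x≥y → *-monoˡ-≤ 2 (/-monoˡ-≤ 2 x≥y)) sorted)))
  (replicate-≥ (oddCount xs))
  -- Positivity of a lowered part already says that it is at least 1, so it may precede the ones.
  (All.map (λ x>0 → All.replicate⁺ (oddCount xs) x>0) (All.all-filter (_>? 0) (evenParts xs)))

split-isPartition : ∀ {n xs} → IsPartition n xs → IsPartition n (split xs)
split-isPartition {xs = xs} (sorted , _ , eq) =
  AllPairs⇒Linked (split-≥ (Linked⇒AllPairs ≥-trans sorted)) ,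
  split-positive xs ,
  trans (sum-split xs) eq

odd≡1⇒evenAboveOdd : ∀ {xs} → All (_> 0) xs → All (λ x → Odd x → x ≡ 1) xs → EvenAboveOdd xs
odd≡1⇒evenAboveOdd positive odd≡1 =
  All.map (λ x>0 → All.map (λ y≡1 → above x>0 y≡1) odd≡1) positive
  where
  above : ∀ {x y} → x > 0 → (Odd y → y ≡ 1) → Even x → Odd y → x > y
  above {x} x>0 y≡1 even odd with refl ← y≡1 odd =
    -- `x>0` unfolds to `1 ≤ x`, and an even `x` is not 1.
    ≤∧≢⇒< x>0 λ { refl → odd-1 even }

all-odd⇒evenAboveOdd : ∀ {xs} → All Odd xs → EvenAboveOdd xs
all-odd⇒evenAboveOdd {xs} odds =
  All.map (λ odd → All.universal (λ _ even _ → contradiction even odd) xs) odds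

-- Recovering a partition from its image.

all-even⇒oddCount≡0 : ∀ {xs} → All Even xs → oddCount xs ≡ 0
all-even⇒oddCount≡0 []                     = refl
all-even⇒oddCount≡0 (_∷_ {x} even evens) =
  cong₂ _+_ (n∣m⇒m%n≡0 x 2 even) (all-even⇒oddCount≡0 evens)

all-even⇒lower≡id : ∀ {xs} → All (_> 0) xs → All Even xs → lower xs ≡ xs
all-even⇒lower≡id positive evens =
  trans (cong (filter (_>? 0)) (map-id-local (All.map m/n*n≡m evens)))
        (filter-all (_>? 0) positive)

all-≤1⇒lower≡[] : ∀ {xs} → All (_≤ 1) xs → lower xs ≡ []
all-≤1⇒lower≡[] ≤1s = filter-none (_>? 0) (All.map⁺ (All.map not-positive ≤1s))
  where
  not-positive : ∀ {x} → x ≤ 1 → x / 2 * 2 ≯ 0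
  not-positive z≤n       ()
  not-positive (s≤s z≤n) ()

-- The implication `Even x → Even y` puts the odd parts first, so the first `oddCount xs` entries,
-- which `raise` increases, are the ones that were lowered.
raise-lower : ∀ {xs} → All (_> 0) xs → AllPairs (λ x y → x ≥ y × (Even x → Even y)) xs →
  raise (oddCount xs) (lower xs) ≡ xs
raise-lower [] [] = refl
raise-lower {x ∷ xs} (x>0 ∷ positive) (below ∷ ordered) with even? x
-- From an even part on everything is even: `lower` changes nothing and `raise` has no ones left to
-- add.
... | yes even
  rewrite all-even⇒oddCount≡0 (even ∷ All.map (λ b → proj₂ b even) below)
  = all-even⇒lower≡id (x>0 ∷ positive) (even ∷ All.map (λ b → proj₂ b even) below)
... | no odd with x / 2 * 2 in x/2*2≡
-- Here `x` is 1, so all later parts are at most 1, `lower` leaves nothing, and every part comes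
-- back from the padding.
...   | zero with refl ← trans (cong suc (sym x/2*2≡)) (odd⇒suc-evenPart odd)
  rewrite all-≤1⇒lower≡[] (All.map proj₁ below)
  = cong (1 ∷_) (subst (λ es → raise (oddCount xs) es ≡ xs)
                       (all-≤1⇒lower≡[] (All.map proj₁ below)) (raise-lower positive ordered))
...   | suc e
  rewrite odd⇒%2≡1 odd
  = cong₂ _∷_ (trans (cong suc (sym x/2*2≡)) (odd⇒suc-evenPart odd)) (raise-lower positive ordered)

filter-even-split : ∀ xs → filter even? (split xs) ≡ lower xs
filter-even-split xs = begin
  filter even? (lower xs ++ ones)               ≡⟨ filter-++ even? (lower xs) ones ⟩
  filter even? (lower xs) ++ filter even? ones  ≡⟨ cong₂ _++_ (filter-all even? (lower-even xs))
                                                    (filter-none even? (All.replicate⁺ (oddCount xs) odd-1)) ⟩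
  lower xs ++ []                                ≡⟨ ++-identityʳ (lower xs) ⟩
  lower xs                                      ∎
  where
  open ≡-Reasoning
  ones = replicate (oddCount xs) 1

filter-odd-split : ∀ xs → filter odd? (split xs) ≡ replicate (oddCount xs) 1
filter-odd-split xs = begin
  filter odd? (lower xs ++ ones)              ≡⟨ filter-++ odd? (lower xs) ones ⟩
  filter odd? (lower xs) ++ filter odd? ones  ≡⟨ cong₂ _++_
                                                   (filter-none odd? (All.map contradiction (lower-even xs)))
                                                   (filter-all odd? (All.replicate⁺ (oddCount xs) odd-1)) ⟩
  ones                                        ∎
  where
  open ≡-Reasoning
  ones = replicate (oddCount xs) 1

unsplit-split : ∀ {n xs} → IsPartition n xs → OddAboveEven xs → unsplit (split xs) ≡ xs
unsplit-split {xs = xs} (sorted , positive , _) oddAbove = begin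
  raise (length (filter odd? (split xs))) (filter even? (split xs))
    ≡⟨ cong₂ raise (trans (cong length (filter-odd-split xs)) (length-replicate (oddCount xs)))
                   (filter-even-split xs) ⟩
  raise (oddCount xs) (lower xs)
    ≡⟨ raise-lower positive (ordered (Linked⇒AllPairs ≥-trans sorted) oddAbove) ⟩
  xs ∎
  where
  open ≡-Reasoning
  -- An odd part after an even one would have to exceed it, against the order.
  even-below : ∀ {x y} → x ≥ y → (Odd y → Even x → y > x) → Even x → Even y
  even-below {y = y} x≥y above even with even? y
  ... | yes even′ = even′
  ... | no  odd   = contradiction (above odd even) (≤⇒≯ x≥y)
  ordered : ∀ {xs} → AllPairs _≥_ xs → OddAboveEven xs →
            AllPairs (λ x y → x ≥ y × (Even x → Even y)) xs
  ordered [] _ = []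
  ordered (ge ∷ ges) (_ ∷ above) =
    -- `a` compares the later part with the head of the list, which is the first entry in that
    -- part's row of comparisons.
    All.zipWith (λ { (x≥y , (a ∷ _)) → x≥y , even-below x≥y a }) (ge , above)
    ∷ ordered ges (All.map All.tail above)

-- A partition outside the image, and the two inequalities.

extra : ∀ {n} → n ≥ 3 →
  ∃₂ λ m ms → m > 1 × Odd m × IsPartition n (m ∷ ms) × EvenAboveOdd (m ∷ ms)
extra {suc n} (s≤s n≥2) with even? (suc n)
... | no odd = suc n , [] , s≤s (≤-trans (s≤s z≤n) n≥2) , odd ,
  ([-] , s≤s z≤n ∷ [] , +-identityʳ (suc n)) , all-odd⇒evenAboveOdd (odd ∷ [])
-- The number partitioned is `suc n`, so `n` is odd. The bound 3 is what makes `n` exceed 1: for 2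
-- this would be (1, 1), which `split` does reach.
... | yes even = n , [ 1 ] , n≥2 , odd ,
  (n≥1 ∷ [-] , n≥1 ∷ ≤-refl ∷ [] , +-comm n 1) , all-odd⇒evenAboveOdd (odd ∷ odd-1 ∷ [])
  where
  odd = even-suc⇒odd even
  n≥1 = ≤-trans (s≤s z≤n) n≥2

theorem3p3 : (∀ (n : ℕ) → pᵒᵘₑᵤ n ≤ pᵉᵘₒᵤ n) × (∀ (n : ℕ) → n ≥ 3 → pᵒᵘₑᵤ n < pᵉᵘₒᵤ n)
theorem3p3 = weak , strict
  where
  source target image : ℕ → List (List ℕ)
  source n = filter oddAboveEven? (partitions n)
  target n = filter evenAboveOdd? (partitions n)
  image n  = map split (source n)

  image-unique : ∀ n → Unique (image n)
  image-unique n = Unique-map-leftInverse split unsplit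
    (All.tabulate λ i → let j , oddAbove = ∈-filter⁻ oddAboveEven? {xs = partitions n} i
                        in unsplit-split (∈-partitions⁻ {n} j) oddAbove)
    (Unique.filter⁺ oddAboveEven? (partitions-unique n))

  image⊆target : ∀ n → image n ⊆ target n
  image⊆target n i with xs , j , refl ← ∈-map⁻ split i =
    ∈-filter⁺ evenAboveOdd?
      (∈-partitions⁺ {n} (split-isPartition
        (∈-partitions⁻ {n} (proj₁ (∈-filter⁻ oddAboveEven? {xs = partitions n} j)))))
      (odd≡1⇒evenAboveOdd (split-positive xs) (split-odd≡1 xs))

  weak : ∀ n → pᵒᵘₑᵤ n ≤ pᵉᵘₒᵤ n
  weak n = subst (_≤ pᵉᵘₒᵤ n) (length-map split (source n))
    (Unique-⊆⇒length≤ (image-unique n) (image⊆target n))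

  strict : ∀ n → n ≥ 3 → pᵒᵘₑᵤ n < pᵉᵘₒᵤ n
  strict n n≥3 with m , ms , m>1 , odd , part , evenAbove ← extra n≥3 =
    subst (_< pᵉᵘₒᵤ n) (length-map split (source n))
      -- The extra partition in front of the image keeps the list duplicate-free and inside the
      -- target; its additional entry is the `suc` in `<`.
      (Unique-⊆⇒length≤ (All.¬Any⇒All¬ _ m∷ms∉image ∷ image-unique n)
        λ { (here refl) → ∈-filter⁺ evenAboveOdd? (∈-partitions⁺ {n} part) evenAbove
          ; (there i)   → image⊆target n i })
    where
    m∷ms∉image : m ∷ ms ∉ image n
    m∷ms∉image i with xs , _ , eq ← ∈-map⁻ split i =
      -- Were the list an image, its odd head `m` would equal 1.
      <⇒≢ m>1 (sym (All.head (subst (All (λ x → Odd x → x ≡ 1)) (sym eq) (split-odd≡1 xs)) odd))
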